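{- Let $\{\{X_s:s\in\omega^{n+1}\}:n\in\omega\}$ be a family such that for every $n\in\omega$, $\{X_s:s\in\omega^{n+1}\}$ is a partition of $\omega$ into infinite sets, and such that $\bigcap_{i\in F}X_{s_i}$ is infinite for every finite $F\subseteq\omega$ and every choice of $s_i\in\omega^{i+1}$, $i\in F$. Let $\mathrm{Fin}'_\omega$ be the ideal on $\omega$ defined from this family as in the context. Then $\mathrm{Fin}'_\omega$ is a $\mathbf{\Sigma^0_\omega}$ ideal and $\mathrm{rk}(\mathrm{Fin}'_\omega)=\omega$.
   Context: An ideal on a countably infinite set $X$ is a family $\mathcal{I}\subseteq\mathcal{P}(X)$ closed under subsets and finite unions, with $X\notin\mathcal{I}$ and containing all finite subsets of $X$; write $\mathrm{dom}(\mathcal{I})=X$ and $\mathcal{I}^\star=\{X\setminus A:A\in\mathcal{I}\}$. $\mathcal{P}(X)$ is identified with $2^X$ (product topology), so Borel classes of families of subsets make sense. $\mathrm{Fin}$ is the ideal of finite subsets of $\omega$. For $n\ge1$ the ideal $\mathrm{Fin}^n$ on $\omega^n$ is defined by $\mathrm{Fin}^1=\mathrm{Fin}$ and: $A\subseteq\omega^{n+1}$ is in $\mathrm{Fin}^{n+1}$ iff $\{i\in\omega:\{x\in\omega^n:(i,x)\in A\}\notin\mathrm{Fin}^n\}$ is finite. For $n\in\omega$, $\mathrm{Fin}^{n+2}(\{X_s:s\in\omega^{n+1}\})$ is the family of all $A\subseteq\omega$ such that $\{s\in\omega^{n+1}: A\cap X_s \text{ is infinite}\}\in\mathrm{Fin}^{n+1}$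 (equivalently, the isomorphic copy of $\mathrm{Fin}^{n+2}$ on $\omega$ induced by any bijection $\sigma:\omega^{n+2}\to\omega$ with $\sigma[\{s\}\times\omega]=X_s$ for all $s\in\omega^{n+1}$). $\mathrm{Fin}'_\omega$ is the ideal on $\omega$ generated by $\bigcup_{n\in\omega}\mathrm{Fin}^{n+2}(\{X_s:s\in\omega^{n+1}\})$, i.e. the sets contained in a finite union of members of this family. For an analytic ideal $\mathcal{I}$, its rank $\mathrm{rk}(\mathcal{I})$ is the least $\alpha<\omega_1$ such that there is $\mathcal{S}\in\mathbf{\Sigma^0_{1+\alpha}}$ with $\mathcal{I}\subseteq\mathcal{S}$ and $\mathcal{I}^\star\cap\mathcal{S}=\emptyset$. -}

module Defs where

open import Data.Nat using (ℕ; zero; suc; _≤_)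
open import Data.Bool using (Bool; true; false; _∨_; _∧_; not)
open import Data.Fin using (Fin)
open import Data.Vec using (Vec; []; _∷_)
open import Data.List using (List; []; _∷_)
open import Data.List.Relation.Unary.All using (All)
open import Data.Maybe using (Maybe; just; nothing)
open import Data.Product using (Σ; ∃; ∃-syntax; _×_; _,_)
open import Data.Unit using (⊤)
open import Data.Empty using (⊥)
open import Relation.Nullary using (¬_)
open import Relation.Binary.PropositionalEquality using (_≡_)
open import Function using (_∘_)
import Level
open import Level using (Lift)
open import Function.Bundles using (_⇔_)

Subset : Set
Subset = ℕ → Bool

Family : Set₁
Family = Subset → Set

_∩_ : Subset → Subset → Subset
(A ∩ B) m = A m ∧ B m

_∪_ : Subset → Subset → Subset
(A ∪ B) m = A m ∨ B m

compl : Subset → Subset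
compl A m = not (A m)

_⊆_ : Subset → Subset → Set
A ⊆ B = ∀ m → A m ≡ true → B m ≡ true

Infinite : Subset → Set
Infinite A = ∀ N → ∃[ k ] (N ≤ k × A k ≡ true)

Finite : Subset → Set
Finite A = ∃[ N ] (∀ k → N ≤ k → A k ≡ false)

record IsIdeal (I : Family) : Set where
  field
    downward : ∀ A B → A ⊆ B → I B → I A
    union    : ∀ A B → I A → I B → I (A ∪ B)
    proper   : ¬ I (λ _ → true)
    finite   : ∀ A → Finite A → I A

_⋆ : Family → Family
(I ⋆) A = I (compl A)

-- The ideals Fin^{n+1} on ω^{n+1} (ω^{n+1} = Vec ℕ (suc n)),
-- applied to arbitrary predicates on ω^{n+1}.

InFin : (n : ℕ) → (Vec ℕ (suc n) → Set) → Set
InFin zero    B = ∃[ N ] (∀ k → N ≤ k → ¬ B (k ∷ []))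
InFin (suc n) B = ∃[ N ] (∀ i → N ≤ i → InFin n (λ x → B (i ∷ x)))

PartFamily : Set
PartFamily = (n : ℕ) → Vec ℕ (suc n) → Subset

FinX : PartFamily → (n : ℕ) → Family
FinX X n A = InFin n (λ s → Infinite (A ∩ X n s))

Fin'ω : PartFamily → Family
Fin'ω X A =
  ∃[ k ] Σ (Fin k → ℕ) λ lev → Σ (Fin k → Subset) λ B →
    (∀ j → FinX X (lev j) (B j)) ×
    (∀ m → A m ≡ true → ∃[ j ] (B j m ≡ true))

IsPartitionFamily : PartFamily → Set
IsPartitionFamily X =
  (∀ n m → ∃[ s ] (X n s m ≡ true)) ×
  (∀ n m s t → X n s m ≡ true → X n t m ≡ true → s ≡ t) ×
  (∀ n s → Infinite (X n s))

-- ⋂_{i ∈ F} X_{s_i} infinite for all finite F ⊆ ω and all choices s_i ∈ ω^{i+1}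
-- (F given as a list; c i = s_i, only values for i ∈ F matter)
IntersectionsInfinite : PartFamily → Set
IntersectionsInfinite X =
  ∀ (F : List ℕ) (c : (i : ℕ) → Vec ℕ (suc i)) →
    ∀ N → ∃[ k ] (N ≤ k × All (λ i → X i (c i) k ≡ true) F)

-- Borel classes on 2^ω.  Σ⁰ n is the class Σ^0_{n+1}, Π⁰ n is Π^0_{n+1}.

Extends : List Bool → Subset → Set
Extends []      x = ⊤
Extends (b ∷ p) x = x 0 ≡ b × Extends p (x ∘ suc)

BasicOpen : Maybe (List Bool) → Subset → Set
BasicOpen nothing  x = ⊥
BasicOpen (just p) x = Extends p x

mutual
  Σ⁰ : ℕ → Family → Set₁
  Σ⁰ zero    S = Lift (Level.suc Level.zero) (Σ (ℕ → Maybe (List Bool)) λ p →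
                   ∀ x → S x ⇔ (∃[ i ] BasicOpen (p i) x))
  Σ⁰ (suc n) S = Σ (ℕ → Family) λ T → (∀ i → Π⁰ n (T i)) ×
                   (∀ x → S x ⇔ (∃[ i ] T i x))

  Π⁰ : ℕ → Family → Set₁
  Π⁰ n S = Σ Family λ U → Σ⁰ n U × (∀ x → S x ⇔ (¬ U x))

Σ⁰ω : Family → Set₁
Σ⁰ω S = Σ (ℕ → Family) λ T → Σ (ℕ → ℕ) λ lev →
          (∀ i → Π⁰ (lev i) (T i)) × (∀ x → S x ⇔ (∃[ i ] T i x))

Separates : Family → Family → Set
Separates S I = (∀ A → I A → S A) × (∀ A → (I ⋆) A → ¬ S A)

-- rk(I) = ω : a Σ^0_{1+ω} = Σ^0_ω separator exists, and for no finite α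
-- is there a Σ^0_{1+α} = Σ^0_{α+1} (= Σ⁰ α) separator.
RankIsω : Family → Set₁
RankIsω I = (Σ Family λ S → Σ⁰ω S × Separates S I) ×
            (∀ α S → Σ⁰ α S → ¬ Separates S I)

{-# OPTIONS --safe #-}
module Submission where

-- Identify FinX X n with the sets A admitting g : ℕ → ℕ such that for every x ∈ A, with x ∈ X n s,
-- the sequence 0 , s , x takes somewhere a step p , v with v < g p.  Then A ∈ Fin'ω iff for some n
-- a single g defeats every x ∈ A on one of the levels below n.  The quantifier over g is removed
-- by a game with boundedly many rounds: the opponent names indices p₁ < p₂ < …, each answered by a
-- value g(pᵢ).  Answers for all the plays can be merged into one g because only finitely many
-- p ≤ q matter at q.  Winning positions of a K-round game are given by a Π∃…Π∃ closed condition, so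
-- Fin'ω is Σ⁰_ω.
--
-- For the lower bound, every Σ⁰ n set S has approximations φ s k x depending only on the part of x
-- below k, which for almost all (s , k) tell correctly whether x ∈ S.  Setting A k = φ s k A for
-- k ∈ X n s defines a set A which is in the dual filter if A ∈ S and in the ideal otherwise.

open import Defs
open import Level using (0ℓ; lift)
open import Data.Bool using (Bool; true; false; not; _∧_; _∨_)
open import Data.Bool.Properties using (∨-inverseʳ; not-injective; ¬-not; not-¬)
open import Data.Empty using (⊥-elim)
open import Data.Fin using (Fin; toℕ; fromℕ; fromℕ<; inject₁; splitAt; _↑ˡ_; _↑ʳ_) renaming (zero to fzero; suc to fsuc)
open import Data.Fin.Properties using (toℕ<n; toℕ-fromℕ; toℕ-fromℕ<; toℕ-inject₁; splitAt-↑ˡ; splitAt-↑ʳ)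
open import Data.List using (List; []; _∷_; _++_; length; upTo)
open import Data.List.Properties using (length-++)
open import Data.List.Membership.Propositional.Properties using (∈-upTo⁺)
open import Data.List.Relation.Unary.All as All using (All; []; _∷_)
open import Data.List.Relation.Unary.All.Properties using (++⁺; ++⁻ˡ; ++⁻ʳ)
open import Data.Maybe using (Maybe; just; nothing)
open import Data.Nat
open import Data.Nat.Binary using (ℕᵇ; 2[1+_]; 1+[2_]) renaming (zero to 0ᵇ; toℕ to toℕᵇ; fromℕ to fromℕᵇ)
open import Data.Nat.Binary.Properties using (fromℕ-toℕ)
open import Data.Nat.Properties
open import Data.Product using (Σ; ∃-syntax; _×_; _,_; proj₁; proj₂; map₂)
open import Data.Sum using (inj₁; inj₂; [_,_]′)
open import Data.Unit using (⊤; tt)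
open import Data.Vec using (Vec; []; _∷_)
open import Function using (_∘_; id)
open import Function.Bundles using (_⇔_; mk⇔; Equivalence)
open import Relation.Nullary using (¬_; Dec; yes; no; does)
open import Relation.Nullary.Decidable using (dec-true; dec-false; does-⇔; decidable-stable)
open import Relation.Binary.PropositionalEquality
open import Axiom.ExcludedMiddle using (ExcludedMiddle)

open Equivalence using (to; from)

sup : ∀ {k} → (Fin k → ℕ) → ℕ
sup {zero}  f = 0
sup {suc k} f = f fzero ⊔ sup (f ∘ fsuc)

≤sup : ∀ {k} (f : Fin k → ℕ) j → f j ≤ sup f
≤sup f fzero    = m≤m⊔n _ _
≤sup f (fsuc j) = ≤-trans (≤sup (f ∘ fsuc) j) (m≤n⊔m (f fzero) _)

supUpTo : (ℕ → ℕ) → ℕ → ℕ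
supUpTo f q = sup {suc q} (f ∘ toℕ)

≤supUpTo : ∀ f {p q} → p ≤ q → f p ≤ supUpTo f q
≤supUpTo f {p} {q} p≤q =
  subst (λ r → f r ≤ supUpTo f q) (toℕ-fromℕ< (s≤s p≤q)) (≤sup (f ∘ toℕ) (fromℕ< (s≤s p≤q)))

-- Constraints and the quantifier "for almost all"

Constraint : Set
Constraint = ℕ × ℕ

Meets : (ℕ → ℕ) → Constraint → Set
Meets g (q , v) = g q ≤ v

Good : (ℕ → ℕ) → List Constraint → Set
Good g = All (Meets g)

-- Pairing each entry with its predecessor makes a threshold depend on the preceding coordinate
-- alone, not on the whole prefix; `AE-suc` shows that this loses nothing.
pairs : ∀ {n} → ℕ → Vec ℕ n → ℕ → List Constraint
pairs t []      k = (t , k) ∷ []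
pairs t (i ∷ s) k = (t , i) ∷ pairs i s k

length-pairs : ∀ {n} t (s : Vec ℕ n) k → length (pairs t s k) ≡ suc n
length-pairs t []      k = refl
length-pairs t (i ∷ s) k = cong suc (length-pairs i s k)

Good-antitone : ∀ {g h} → (∀ q → h q ≤ g q) → ∀ {L} → Good g L → Good h L
Good-antitone h≤g = All.map (λ {e} → ≤-trans (h≤g (proj₁ e)))

-- As `q ≤ g q`, a good sequence never decreases, so its indices stay at or above `i`, where `h` is
-- dominated.
Good-antitone-above : ∀ {g h i} → (∀ q → q ≤ g q) → (∀ q → i ≤ q → h q ≤ g q) →
  ∀ {n} j (s : Vec ℕ n) k → i ≤ j → Good g (pairs j s k) → Good h (pairs j s k)
Good-antitone-above q≤g h≤g j []      k i≤j (a ∷ []) = ≤-trans (h≤g j i≤j) a ∷ []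
Good-antitone-above q≤g h≤g j (m ∷ s) k i≤j (a ∷ as) =
  ≤-trans (h≤g j i≤j) a ∷
  Good-antitone-above q≤g h≤g m s k (≤-trans i≤j (≤-trans (q≤g j) a)) as

-- AE n t P: P holds for Fin^{n+1}-almost all (s , k).
AE : ∀ n → ℕ → (Vec ℕ n → ℕ → Set) → Set
AE n t P = ∃[ g ] (∀ s k → Good g (pairs t s k) → P s k)

AE-map : ∀ {n t} {P Q : Vec ℕ n → ℕ → Set} → (∀ {s k} → P s k → Q s k) → AE n t P → AE n t Q
AE-map f (g , h) = g , λ s k good → f (h s k good)

AE-⋂ : ∀ {n t} {P : ℕ → Vec ℕ n → ℕ → Set} → (∀ j → AE n t (P j)) →
  ∀ i → AE n t (λ s k → ∀ j → j ≤ i → P j s k)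
AE-⋂ h i = (λ q → supUpTo (λ j → proj₁ (h j) q) i) , λ s k good j j≤i →
  proj₂ (h j) s k (Good-antitone (λ q → ≤supUpTo (λ j → proj₁ (h j) q) j≤i) good)

-- A good sequence starting with `i` visits only indices `q ≥ i`, so at `q` only the finitely many
-- bounds with `i ≤ q` must be dominated.
AE-suc : ∀ {n t} {P : Vec ℕ (suc n) → ℕ → Set} N →
  (∀ i → N ≤ i → AE n i (P ∘ (i ∷_))) → AE (suc n) t P
AE-suc {n} {t} {P} N h = g , prf
  where
  bound : ∀ i → Dec (N ≤ i) → ℕ → ℕ
  bound i (yes N≤i) = proj₁ (h i N≤i)
  bound i (no _)    = λ _ → 0

  diagonal : ℕ → ℕ
  diagonal q = supUpTo (λ i → bound i (N ≤? i) q) q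

  -- `N` rules out small first coordinates, and `q` makes good sequences monotone.
  g : ℕ → ℕ
  g q = N ⊔ (q ⊔ diagonal q)

  q≤g : ∀ q → q ≤ g q
  q≤g q = ≤-trans (m≤m⊔n q _) (m≤n⊔m N _)

  bound≤g : ∀ i q → i ≤ q → bound i (N ≤? i) q ≤ g q
  bound≤g i q i≤q = ≤-trans (≤supUpTo (λ i → bound i (N ≤? i) q) i≤q)
                      (≤-trans (m≤n⊔m q _) (m≤n⊔m N _))

  prf : ∀ s k → Good g (pairs t s k) → P s k
  prf (i ∷ s) k (a ∷ as) with N ≤? i | bound≤g i
  ... | yes N≤i | b = proj₂ (h i N≤i) s k (Good-antitone-above q≤g b i s k ≤-refl as)
  ... | no N≰i  | _ = ⊥-elim (N≰i (≤-trans (m≤m⊔n N _) a))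

Eventually : (ℕ → Set) → Set
Eventually P = ∃[ M ] (∀ k → M ≤ k → P k)

Good⇒InFin : ∀ n t g {B : Vec ℕ (suc n) → Set} →
  (∀ s → Eventually (λ k → Good g (pairs t s k)) → ¬ B s) → InFin n B
Good⇒InFin zero    t g h =
  g t , λ i gt≤i → h (i ∷ []) (g i , λ k gi≤k → gt≤i ∷ gi≤k ∷ [])
Good⇒InFin (suc n) t g h =
  g t , λ i gt≤i → Good⇒InFin n i g λ s (M , e) → h (i ∷ s) (M , λ k M≤k → gt≤i ∷ e k M≤k)

goodVec : (g : ℕ → ℕ) → ∀ n t → Σ (Vec ℕ n) λ s → Eventually (λ k → Good g (pairs t s k))
goodVec g zero    t = [] , g t , λ k gt≤k → gt≤k ∷ []
goodVec g (suc n) t =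
  let (s , M , e) = goodVec g n (g t) in g t ∷ s , M , λ k M≤k → ≤-refl ∷ e k M≤k

-- Fixed points of causal operators

Agree : ℕ → Subset → Subset → Set
Agree k x y = ∀ m → m < k → x m ≡ y m

Causal : (ℕ → Subset → Bool) → Set
Causal F = ∀ k x y → Agree k x y → F k x ≡ F k y

-- Course-of-values recursion: `iter j` is already correct below `j`, so the value at `k` can be
-- read from `iter (suc k)`.
fixpoint : ∀ F → Causal F → ∃[ A ] (∀ k → A k ≡ F k A)
fixpoint F causal = A , λ k → causal k (iter k) A (agree k)
  where
  iter : ℕ → Subset
  iter zero    = λ _ → false
  iter (suc j) = λ k → F k (iter j)

  A : Subset
  A k = iter (suc k) k

  step : ∀ j → Agree j (iter j) (iter (suc j))
  step (suc j) m (s≤s m≤j) =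
    causal m (iter j) (iter (suc j)) λ l l<m → step j l (<-≤-trans l<m m≤j)

  agree : ∀ k → Agree k (iter k) A
  agree (suc k) m (s≤s m≤k) with m≤n⇒m<n∨m≡n m≤k
  ... | inj₁ m<k  = trans (sym (step k m m<k)) (agree k m m<k)
  ... | inj₂ refl = refl

-- Open sets and an enumeration of bit strings

Open : Family → Set
Open S = ∀ x → S x → ∃[ k ] (∀ y → Agree k x y → S y)

Extends-respects-Agree : ∀ l {x y} → Agree (length l) x y → Extends l x → Extends l y
Extends-respects-Agree []      eq _         = tt
Extends-respects-Agree (b ∷ l) eq (e , ext) =
  trans (sym (eq 0 (s≤s z≤n))) e ,
  Extends-respects-Agree l (λ m m<l → eq (suc m) (s≤s m<l)) ext

Σ⁰-zero⇒Open : ∀ {S} → Σ⁰ 0 S → Open S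
Σ⁰-zero⇒Open (lift (p , S⇔)) x Sx with to (S⇔ x) Sx
... | i , ext with p i in eq
...   | just l = length l , λ y agr → from (S⇔ y) (i , subst (λ c → BasicOpen c y) (sym eq)
                    (Extends-respects-Agree l agr ext))

-- Bijective binary numerals have one empty and two unary constructors, so they are bit lists; this
-- enumerates the cylinders.
toBits : ℕᵇ → List Bool
toBits 0ᵇ       = []
toBits 2[1+ b ] = true ∷ toBits b
toBits 1+[2 b ] = false ∷ toBits b

fromBits : List Bool → ℕᵇ
fromBits []          = 0ᵇ
fromBits (true ∷ l)  = 2[1+ fromBits l ]
fromBits (false ∷ l) = 1+[2 fromBits l ]

toBits-fromBits : ∀ l → toBits (fromBits l) ≡ l
toBits-fromBits []          = refl
toBits-fromBits (true ∷ l)  = cong (true ∷_) (toBits-fromBits l)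
toBits-fromBits (false ∷ l) = cong (false ∷_) (toBits-fromBits l)

bits : ℕ → List Bool
bits = toBits ∘ fromℕᵇ

bits-surjective : ∀ l → ∃[ i ] bits i ≡ l
bits-surjective l =
  toℕᵇ (fromBits l) , trans (cong toBits (fromℕ-toℕ (fromBits l))) (toBits-fromBits l)

restrict : ℕ → Subset → List Bool
restrict zero    x = []
restrict (suc k) x = x 0 ∷ restrict k (x ∘ suc)

Extends-restrict : ∀ k x → Extends (restrict k x) x
Extends-restrict zero    x = tt
Extends-restrict (suc k) x = refl , Extends-restrict k (x ∘ suc)

Extends-restrict⇒Agree : ∀ k x {y} → Extends (restrict k x) y → Agree k x y
Extends-restrict⇒Agree (suc k) x (e , ext) zero    _         = sym e
Extends-restrict⇒Agree (suc k) x (e , ext) (suc m) (s≤s m<k) =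
  Extends-restrict⇒Agree k (x ∘ suc) ext m m<k

-- Counting constraints of index at least `t`

data AtMost (t : ℕ) : ℕ → List Constraint → Set where
  []   : ∀ {K} → AtMost t K []
  skip : ∀ {K e l} → proj₁ e < t → AtMost t K l → AtMost t K (e ∷ l)
  keep : ∀ {K e l} → AtMost t K l → AtMost t (suc K) (e ∷ l)

atMost-length : ∀ {t} l → AtMost t (length l) l
atMost-length []      = []
atMost-length (e ∷ l) = keep (atMost-length l)

AtMost-raise : ∀ {t u K l} → t ≤ u → AtMost t K l → AtMost u K l
AtMost-raise t≤u []         = []
AtMost-raise t≤u (skip b m) = skip (<-≤-trans b t≤u) (AtMost-raise t≤u m)
AtMost-raise t≤u (keep m)   = keep (AtMost-raise t≤u m)

AtMost-zero : ∀ {t l} → AtMost t 0 l → All (λ e → proj₁ e < t) l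
AtMost-zero []         = []
AtMost-zero (skip b m) = b ∷ AtMost-zero m

-- Moving past the smallest index not below `t` uses up a constraint, so the budget drops by one; if
-- there is no such index, any `d` would do.
least-index : ∀ {t K l} → AtMost t (suc K) l →
  ∃[ d ] (All (λ e → t ≤ proj₁ e → t + d ≤ proj₁ e) l × AtMost (suc (t + d)) K l)
least-index []         = 0 , [] , []
least-index {t} (skip q<t m) =
  let (d , least , m′) = least-index m
  in d , (λ t≤q → ⊥-elim (<⇒≱ q<t t≤q)) ∷ least ,
     skip (<-≤-trans q<t (≤-trans (m≤m+n t d) (n≤1+n _))) m′
least-index {t} (keep {zero} {q , _} m) =
  q ∸ t , (λ t≤q → ≤-reflexive (m+[n∸m]≡n t≤q)) ∷
          All.map (λ r<t t≤r → ⊥-elim (<⇒≱ r<t t≤r)) (AtMost-zero m) ,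
  skip (s≤s (m≤n+m∸n q t)) (AtMost-raise (≤-trans (m≤m+n t _) (n≤1+n _)) m)
least-index {t} (keep {suc K} {q , _} m) with least-index m
... | d , least , m′ with t + d ≤? q
...   | yes p≤q = d , (λ _ → p≤q) ∷ least , keep m′
...   | no p≰q  =
  q ∸ t , (λ t≤q → ≤-reflexive (m+[n∸m]≡n t≤q)) ∷
          All.map (λ p≤ t≤r → ≤-trans (+-monoʳ-≤ t (∸-monoˡ-≤ t (≤-trans (<⇒≤ (≰⇒> p≰q)) (p≤ t≤r))))
                                      (≤-reflexive (m+[n∸m]≡n t≤r))) least ,
  skip (s≤s (m≤n+m∸n q t)) (AtMost-raise (≤-trans (m≤m+n t _) (n≤1+n _)) m)

-- The game on lists of constraints

module Game (L : ℕ → List Constraint) where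

  -- `x` stays in play when `p` is named: none of its indices from `t` on is jumped over, and its
  -- values at `p` reach the answer `N`.
  Passes : ℕ → ℕ → ℕ → ℕ → Set
  Passes t p N x = All (λ (q , v) → t ≤ q → q ≤ p → q ≡ p × N ≤ v) (L x)

  Exhausted : ℕ → ℕ → Set
  Exhausted t x = All (λ (q , v) → q < t) (L x)

  -- In each of K rounds the opponent names an index p = t + d above the earlier ones and
  -- is answered by a threshold N.  Points of A must not survive if the opponent has named
  -- all indices of their constraints.
  Win : ℕ → ℕ → (ℕ → Set) → Family
  Win zero    t C A = ∀ x → C x → Exhausted t x → A x ≡ false
  Win (suc K) t C A =
    ∀ d → ∃[ N ] Win K (suc (t + d)) (λ x → C x × Passes t (t + d) N x) A

  Survives : ℕ → ℕ → (ℕ → ℕ) → ℕ → Set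
  Survives zero    t g x = Exhausted t x
  Survives (suc K) t g x =
    ∃[ d ] (Passes t (t + d) (g (t + d)) x × Survives K (suc (t + d)) g x)

  Survives-antitone : ∀ K {t g h} → (∀ q → t ≤ q → h q ≤ g q) → ∀ {x} →
    Survives K t g x → Survives K t h x
  Survives-antitone zero    h≤g ex           = ex
  Survives-antitone (suc K) {t} h≤g (d , ps , sv) =
    d , All.map (λ f t≤q q≤p → map₂ (≤-trans (h≤g (t + d) (m≤m+n t d))) (f t≤q q≤p)) ps ,
    Survives-antitone K (λ q p<q → h≤g q (≤-trans (m≤m+n t d) (<⇒≤ p<q))) sv

  -- Every index from `t` on is named in some round and its constraint met there: jumping over it
  -- violates `Passes`, and never reaching it violates `Exhausted`.
  Survives⇒Good-above : ∀ K {t g x} → Survives K t g x →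
    All (λ e → t ≤ proj₁ e → Meets g e) (L x)
  Survives⇒Good-above zero    ex =
    All.map (λ q<t t≤q → ⊥-elim (<⇒≱ q<t t≤q)) ex
  Survives⇒Good-above (suc K) {t} {g} (d , ps , sv) =
    All.map (λ {e} (f , r) → combine e f r) (All.zip (ps , Survives⇒Good-above K sv))
    where
    p = t + d
    combine : ∀ e → (t ≤ proj₁ e → proj₁ e ≤ p → proj₁ e ≡ p × g p ≤ proj₂ e) →
      (suc p ≤ proj₁ e → Meets g e) → t ≤ proj₁ e → Meets g e
    combine (q , v) f r t≤q with q ≤? p
    ... | no q≰p = r (≰⇒> q≰p)
    ... | yes q≤p with f t≤q q≤p
    ...   | refl , b = b

  -- The opponent always names the smallest remaining index; the count `K` ensures that the rounds
  -- suffice.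
  Good⇒Survives : ∀ K {t g x} → AtMost t K (L x) → Good g (L x) → Survives K t g x
  Good⇒Survives zero    m good = AtMost-zero m
  Good⇒Survives (suc K) {t} {g} m good with least-index m
  ... | d , least , m′ = d , All.map (λ {e} → pass e) (All.zip (least , good)) , Good⇒Survives K m′ good
    where
    pass : ∀ e → (t ≤ proj₁ e → t + d ≤ proj₁ e) × Meets g e →
      t ≤ proj₁ e → proj₁ e ≤ t + d → proj₁ e ≡ t + d × g (t + d) ≤ proj₂ e
    pass (q , v) (p≤q , b) t≤q q≤p with ≤-antisym q≤p (p≤q t≤q)
    ... | refl = refl , b

  Win⇒threshold : ∀ K {t C A} → Win K t C A →
    ∃[ g ] (∀ x → A x ≡ true → C x → ¬ Survives K t g x)
  Win⇒threshold zero    w = (λ _ → 0) , λ x Ax Cx ex → not-¬ (w x Cx ex) Ax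
  Win⇒threshold (suc K) {t} {C} {A} w = g , prf
    where
    later : ℕ → ℕ → ℕ
    later d = proj₁ (Win⇒threshold K (proj₂ (w d)))

    -- The left part answers the first move `q`, for which `d = q ∸ t`. The right part merges later
    -- answers: only first moves with `d ≤ q` can precede `q`.
    g : ℕ → ℕ
    g q = proj₁ (w (q ∸ t)) ⊔ supUpTo (λ d → later d q) q

    now≤g : ∀ d → proj₁ (w d) ≤ g (t + d)
    now≤g d = subst (λ r → proj₁ (w r) ≤ g (t + d)) (m+n∸m≡n t d)
      (m≤m⊔n (proj₁ (w (t + d ∸ t))) _)

    later≤g : ∀ d q → suc (t + d) ≤ q → later d q ≤ g q
    later≤g d q t+d<q =
      ≤-trans (≤supUpTo (λ d → later d q) (≤-trans (m≤n+m d t) (<⇒≤ t+d<q)))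
              (m≤n⊔m (proj₁ (w (q ∸ t))) _)

    prf : ∀ x → A x ≡ true → C x → ¬ Survives (suc K) t g x
    prf x Ax Cx (d , ps , sv) =
      proj₂ (Win⇒threshold K (proj₂ (w d))) x Ax
        (Cx , All.map (λ f t≤q q≤p → map₂ (≤-trans (now≤g d)) (f t≤q q≤p)) ps)
        (Survives-antitone K (later≤g d) sv)

  threshold⇒Win : ∀ K {t C A g} → (∀ x → A x ≡ true → C x → ¬ Survives K t g x) → Win K t C A
  threshold⇒Win zero    h x Cx ex = ¬-not λ Ax → h x Ax Cx ex
  threshold⇒Win (suc K) {t} {g = g} h d =
    g (t + d) , threshold⇒Win K λ x Ax (Cx , ps) sv → h x Ax Cx (d , ps , sv)

-- Classical thresholds and the Borel class of winning

module Classical (em : ExcludedMiddle 0ℓ) where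

  em-stable : ∀ {P : Set} → ¬ ¬ P → P
  em-stable = decidable-stable em

  ¬Infinite⇒bounded : ∀ C → ¬ Infinite C → Eventually (λ k → C k ≡ false)
  ¬Infinite⇒bounded C ¬inf = em-stable λ ¬bounded → ¬inf λ N → em-stable λ none →
    ¬bounded (N , λ k N≤k → ¬-not λ Ck → none (k , N≤k , Ck))

  -- Bounds are chosen separately on each cell, and `AE-suc` fuses them into one function.
  InFin⇒AE : ∀ n {t} (C : Vec ℕ (suc n) → Subset) → InFin n (λ s → Infinite (C s)) →
    AE (suc n) t (λ s k → C s k ≡ false)
  InFin⇒AE zero    C (N , h) = AE-suc N λ i N≤i →
    let (M , bounded) = ¬Infinite⇒bounded (C (i ∷ [])) (h i N≤i)
    in (λ _ → M) , λ { [] k (M≤k ∷ []) → bounded k M≤k }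
  InFin⇒AE (suc n) C (N , h) = AE-suc N λ i N≤i → InFin⇒AE n (C ∘ (i ∷_)) (h i N≤i)

  Open⇒Σ⁰ : ∀ {S} → Open S → Σ⁰ 0 S
  Open⇒Σ⁰ {S} open′ = lift (cylinder , λ x → mk⇔ (covered x) (sound x))
    where
    Inside : List Bool → Set
    Inside l = ∀ y → Extends l y → S y

    guard : ∀ l → Dec (Inside l) → Maybe (List Bool)
    guard l (yes _) = just l
    guard l (no _)  = nothing

    cylinder : ℕ → Maybe (List Bool)
    cylinder i = guard (bits i) em

    sound-guard : ∀ x l d → BasicOpen (guard l d) x → S x
    sound-guard x l (yes inside) ext = inside x ext

    sound : ∀ x → ∃[ i ] BasicOpen (cylinder i) x → S x
    sound x (i , ext) = sound-guard x (bits i) em ext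

    guard-inside : ∀ x l d → Inside l → Extends l x → BasicOpen (guard l d) x
    guard-inside x l (yes _)     inside ext = ext
    guard-inside x l (no ¬inside) inside ext = ¬inside inside

    covered : ∀ x → S x → ∃[ i ] BasicOpen (cylinder i) x
    covered x Sx with open′ x Sx
    ... | k , near with bits-surjective (restrict k x)
    ...   | i , eq = i , subst (λ l → ∀ d → BasicOpen (guard l d) x) (sym eq)
      (λ d → guard-inside x _ d (λ y ext → near y (Extends-restrict⇒Agree k x ext))
                          (Extends-restrict k x)) em

  -- A round costs two classes: `∃ N` leads to `Σ⁰ (suc n)`, its failure for some `d` is
  -- `Σ⁰ (suc (suc n))`, and the set is the complement of that.
  Π⁰-∀∃ : ∀ {n} (V : ℕ → ℕ → Family) → (∀ d N → Π⁰ n (V d N)) →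
    Π⁰ (suc (suc n)) (λ A → ∀ d → ∃[ N ] V d N A)
  Π⁰-∀∃ V h =
    (λ A → ∃[ d ] ¬ (∃[ N ] V d N A)) ,
    ((λ d A → ¬ (∃[ N ] V d N A)) ,
     (λ d → (λ A → ∃[ N ] V d N A) , (V d , h d , λ A → mk⇔ id id) , λ A → mk⇔ id id) ,
     λ A → mk⇔ id id) ,
    λ A → mk⇔ (λ all (d , none) → none (all d)) (λ h d → em-stable λ none → h (d , none))

  Π⁰-avoids : ∀ (Q : ℕ → Set) → Π⁰ 0 (λ A → ∀ x → Q x → A x ≡ false)
  Π⁰-avoids Q =
    (λ A → ∃[ x ] (Q x × A x ≡ true)) ,
    Open⇒Σ⁰ (λ A (x , Qx , Ax) →
      suc x , λ B agr → x , Qx , trans (sym (agr x (n<1+n x))) Ax) ,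
    λ A → mk⇔ (λ avoids (x , Qx , Ax) → not-¬ (avoids x Qx) Ax)
              (λ h x Qx → ¬-not λ Ax → h (x , Qx , Ax))

  module _ (L : ℕ → List Constraint) where
    open Game L

    level : ℕ → ℕ
    level zero    = 0
    level (suc K) = suc (suc (level K))

    Π⁰-Win : ∀ K t C → Π⁰ (level K) (Win K t C)
    Π⁰-Win zero    t C =
      let (U , σ , eq) = Π⁰-avoids (λ x → C x × Exhausted t x)
      in U , σ , λ A → mk⇔ (λ w → to (eq A) λ x (Cx , ex) → w x Cx ex)
                           (λ ¬U x Cx ex → from (eq A) ¬U x (Cx , ex))
    Π⁰-Win (suc K) t C = Π⁰-∀∃ (λ d N → Win K (suc (t + d)) (λ x → C x × Passes t (t + d) N x))
      λ d N → Π⁰-Win K (suc (t + d)) _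

  -- Approximating sets of finite Borel class

  record Approximation (n : ℕ) (T : Family) : Set where
    field
      φ      : Vec ℕ n → ℕ → Subset → Bool
      causal : ∀ s → Causal (φ s)
      -- The start `t` is arbitrary because in the recursion it is the newly prepended coordinate.
      pos    : ∀ {t} x → T x → AE n t (λ s k → φ s k x ≡ true)
      neg    : ∀ {t} x → ¬ T x → AE n t (λ s k → φ s k x ≡ false)

  open Approximation

  does-em-⇔ : ∀ {P Q : Set} → (P → Q) → (Q → P) → does (em {P}) ≡ does (em {Q})
  does-em-⇔ f g = does-⇔ (mk⇔ f g) em em

  -- A point outside `S` lies in its own cylinders, so there the test never errs; at a point of `S`
  -- it errs only for short cylinders.
  approximateOpen : ∀ {S} → Open S → Approximation 1 S
  approximateOpen {S} open′ = record
    { φ      = λ s k x → does (em {Inside k x})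
    ; causal = λ s k x y agr → does-em-⇔ (transport agr) (transport λ m m<k → sym (agr m m<k))
    ; pos    = λ x Sx → let (M , near) = open′ x Sx in
        (λ _ → M) , λ { (i ∷ []) k (_ ∷ M≤k ∷ []) →
          dec-true em λ y agr → near y λ m m<M → agr m (<-≤-trans m<M M≤k) }
    ; neg    = λ x ¬Sx → (λ _ → 0) , λ s k _ → dec-false em λ inside → ¬Sx (inside x λ _ _ → refl)
    }
    where
    Inside : ℕ → Subset → Set
    Inside k x = ∀ y → Agree k x y → S y

    transport : ∀ {k x y} → Agree k x y → Inside k x → Inside k y
    transport agr inside z agr′ = inside z λ m m<k → trans (agr m m<k) (agr′ m m<k)

  -- The new coordinate `i` bounds the search for `j`. A true witness is found once `i ≥ j`; a false
  -- alarm needs an error in one of finitely many tests, which `AE-⋂` excludes.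
  approximate-∃¬ : ∀ {n S} (U : ℕ → Family) → (∀ i → Approximation n (U i)) →
    (∀ x → S x ⇔ (∃[ i ] ¬ U i x)) → Approximation (suc n) S
  approximate-∃¬ {n} {S} U a S⇔ = record
    { φ      = λ { (i ∷ s) k x → does (em {Refuted i s k x}) }
    ; causal = λ { (i ∷ s) k x y agr →
        does-em-⇔ (map₂ (map₂ (trans (sym (causal (a _) s k x y agr)))))
                  (map₂ (map₂ (trans (causal (a _) s k x y agr)))) }
    ; pos    = λ x Sx → let (j , ¬Uj) = to (S⇔ x) Sx in
        AE-suc j λ i j≤i → AE-map (λ e → dec-true em (j , j≤i , e)) (neg (a j) x ¬Uj)
    ; neg    = λ x ¬Sx → AE-suc 0 λ i _ →
        AE-map (λ e → dec-false em λ (j , j≤i , f) → not-¬ f (e j j≤i))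
               (AE-⋂ (λ j → pos (a j) x (em-stable λ ¬Uj → ¬Sx (from (S⇔ x) (j , ¬Uj)))) i)
    }
    where
    Refuted : ℕ → Vec ℕ n → ℕ → Subset → Set
    Refuted i s k x = ∃[ j ] (j ≤ i × φ (a j) s k x ≡ false)

  approximate : ∀ n {S} → Σ⁰ n S → Approximation (suc n) S
  approximate zero    σ            = approximateOpen (Σ⁰-zero⇒Open σ)
  approximate (suc n) (T , π , S⇔) =
    approximate-∃¬ (λ i → proj₁ (π i)) (λ i → approximate n (proj₁ (proj₂ (π i)))) λ x →
      mk⇔ (λ Sx → let (i , Ti) = to (S⇔ x) Sx in i , to (proj₂ (proj₂ (π i)) x) Ti)
          (λ (i , ¬Ui) → from (S⇔ x) (i , from (proj₂ (proj₂ (π i)) x) ¬Ui))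

  -- The ideal `Fin'ω` in terms of thresholds

  module FinIdeal (X : PartFamily) (part : IsPartitionFamily X) (inter : IntersectionsInfinite X) where

    index : ∀ n → ℕ → Vec ℕ (suc n)
    index n x = proj₁ (proj₁ part n x)

    index∈ : ∀ n x → X n (index n x) x ≡ true
    index∈ n x = proj₂ (proj₁ part n x)

    index-unique : ∀ n {s x} → X n s x ≡ true → s ≡ index n x
    index-unique n {s} {x} e = proj₁ (proj₂ part) n x s (index n x) e (index∈ n x)

    path : ℕ → ℕ → List Constraint
    path n x = pairs 0 (index n x) x

    Misses : ℕ → (ℕ → ℕ) → Family
    Misses n g A = ∀ x → A x ≡ true → ¬ Good g (path n x)

    ∧-true : ∀ {a b} → a ∧ b ≡ true → a ≡ true × b ≡ true
    ∧-true {true} {true} _ = refl , refl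

    FinX⇒Misses : ∀ n A → FinX X n A → ∃[ g ] Misses n g A
    FinX⇒Misses n A fin = let (g , h) = InFin⇒AE n (λ s → A ∩ X n s) fin in
      g , λ x Ax good → not-¬ (h (index n x) x good) (cong₂ _∧_ Ax (index∈ n x))

    -- An infinite trace of `A` on a cell with a good tail would contain a point beyond `M`, whose
    -- path is good.
    Misses⇒FinX : ∀ n g {A} → Misses n g A → FinX X n A
    Misses⇒FinX n g {A} misses = Good⇒InFin n 0 g {λ s → Infinite (A ∩ X n s)} λ s (M , good) infinite →
      let (k , M≤k , e) = infinite M
          (Ak , Xk) = ∧-true e
      in misses k Ak (subst (λ s → Good g (pairs 0 s k)) (index-unique n Xk) (good k M≤k))

    paths : ℕ → ℕ → List Constraint
    paths zero    x = []
    paths (suc n) x = path n x ++ paths n x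

    -- This count is the same for all points, so it can serve as the number of rounds.
    paths-length : ℕ → ℕ
    paths-length zero    = 0
    paths-length (suc n) = suc (suc n) + paths-length n

    length-paths : ∀ n x → length (paths n x) ≡ paths-length n
    length-paths zero    x = refl
    length-paths (suc n) x = trans (length-++ (path n x))
      (cong₂ _+_ (length-pairs 0 (index n x) x) (length-paths n x))

    Good-path : ∀ {g x} i n → i < n → Good g (paths n x) → Good g (path i x)
    Good-path {x = x} i (suc n) (s≤s i≤n) good with m≤n⇒m<n∨m≡n i≤n
    ... | inj₁ i<n  = Good-path i n i<n (++⁻ʳ (path n x) good)
    ... | inj₂ refl = ++⁻ˡ (path n x) good

    Good-paths : ∀ {g x} n → (∀ (i : Fin n) → Good g (path (toℕ i) x)) → Good g (paths n x)
    Good-paths zero    h = []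
    Good-paths {g} {x} (suc n) h =
      ++⁺ (subst (λ i → Good g (path i x)) (toℕ-fromℕ n) (h (fromℕ n)))
          (Good-paths n λ i → subst (λ i → Good g (path i x)) (toℕ-inject₁ i) (h (inject₁ i)))

    MissesAll : ℕ → Family
    MissesAll n A = ∃[ g ] (∀ x → A x ≡ true → ¬ Good g (paths n x))

    -- With `n` above all levels and `g` above all thresholds, a point good on every level would be
    -- good for the piece covering it.
    Fin'ω⇒MissesAll : ∀ {A} → Fin'ω X A → ∃[ n ] MissesAll n A
    Fin'ω⇒MissesAll (k , lev , B , fin , cover) = suc (sup lev) , g , λ x Ax good →
      let (j , Bx) = cover x Ax in
      proj₂ (threshold j) x Bx
        (Good-antitone (λ q → ≤sup (λ j → proj₁ (threshold j) q) j)
          (Good-path (lev j) _ (s≤s (≤sup lev j)) good))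
      where
      threshold : ∀ j → ∃[ g ] Misses (lev j) g (B j)
      threshold j = FinX⇒Misses (lev j) (B j) (fin j)

      g : ℕ → ℕ
      g q = sup (λ j → proj₁ (threshold j) q)

    -- Level `j` contributes the points where `g` fails on that level; a point of `A` outside all
    -- these pieces would be good everywhere.
    MissesAll⇒Fin'ω : ∀ {A} n → MissesAll n A → Fin'ω X A
    MissesAll⇒Fin'ω n (g , misses) =
      n , toℕ , B ,
      (λ j → Misses⇒FinX (toℕ j) g λ x Bx good →
        not-¬ (dec-false em λ ¬good → ¬good good) Bx) ,
      λ x Ax → em-stable λ uncovered → misses x Ax (Good-paths n λ j →
        em-stable λ ¬good → uncovered (j , dec-true em ¬good))
      where
      B : Fin n → Subset
      B j x = does (em {¬ Good g (path (toℕ j) x)})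

    isIdeal : IsIdeal (Fin'ω X)
    isIdeal = record
      { downward = λ A B A⊆B (k , lev , C , fin , cover) →
          k , lev , C , fin , λ m Am → cover m (A⊆B m Am)
      ; union    = λ A B → union A B
      ; proper   = proper
      ; finite   = λ A (N , none) → 1 , (λ _ → 0) , (λ _ → A) ,
          (λ _ → 0 , λ k _ infinite → let (m , N≤m , e) = infinite N in
            not-¬ (none m N≤m) (proj₁ (∧-true e))) ,
          λ m Am → fzero , Am
      }
      where
      union : ∀ A B → Fin'ω X A → Fin'ω X B → Fin'ω X (A ∪ B)
      union A B (k , lev , C , fin , cover) (k′ , lev′ , C′ , fin′ , cover′) =
        k + k′ , [ lev , lev′ ]′ ∘ splitAt k , [ C , C′ ]′ ∘ splitAt k , fins , covers
        where
        fins : ∀ j → FinX X ([ lev , lev′ ]′ (splitAt k j)) ([ C , C′ ]′ (splitAt k j))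
        fins j with splitAt k j
        ... | inj₁ i = fin i
        ... | inj₂ i = fin′ i

        covers : ∀ m → A m ∨ B m ≡ true → ∃[ j ] ([ C , C′ ]′ (splitAt k j) m ≡ true)
        covers m e with A m in eq
        ... | true  = let (i , Ci) = cover m eq in
          i ↑ˡ k′ , trans (cong (λ z → [ C , C′ ]′ z m) (splitAt-↑ˡ k i k′)) Ci
        ... | false = let (i , Ci) = cover′ m e in
          k ↑ʳ i , trans (cong (λ z → [ C , C′ ]′ z m) (splitAt-↑ʳ k k′ i)) Ci

      -- `goodVec` picks a cell with a good tail on each level; the intersection hypothesis gives a
      -- common point beyond all the bounds, good on every level.
      proper : ¬ Fin'ω X (λ _ → true)
      proper all = misses x refl (Good-paths n λ i →
        subst (λ s → Good g (pairs 0 s x)) (index-unique (toℕ i) (All.lookup x∈ (∈-upTo⁺ (toℕ<n i))))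
          (proj₂ (proj₂ (choice (toℕ i))) x (≤-trans (≤sup bound i) bound≤x)))
        where
        n = proj₁ (Fin'ω⇒MissesAll all)
        g = proj₁ (proj₂ (Fin'ω⇒MissesAll all))
        misses = proj₂ (proj₂ (Fin'ω⇒MissesAll all))

        choice : ∀ i → Σ (Vec ℕ (suc i)) λ s → Eventually (λ k → Good g (pairs 0 s k))
        choice i = goodVec g (suc i) 0

        bound : Fin n → ℕ
        bound i = proj₁ (proj₂ (choice (toℕ i)))

        point = inter (upTo n) (λ i → proj₁ (choice i)) (sup bound)
        x = proj₁ point
        bound≤x = proj₁ (proj₂ point)
        x∈ = proj₂ (proj₂ point)

    -- Complexity and rank of `Fin'ω`

    open IsIdeal isIdeal

    Σ⁰ω-Fin'ω : Σ⁰ω (Fin'ω X)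
    Σ⁰ω-Fin'ω =
      (λ n → Game.Win (paths n) (paths-length n) 0 (λ _ → ⊤)) ,
      (λ n → level (paths n) (paths-length n)) ,
      (λ n → Π⁰-Win (paths n) (paths-length n) 0 (λ _ → ⊤)) ,
      λ A → mk⇔ (map₂ (λ {n} → wins n) ∘ Fin'ω⇒MissesAll) (λ (n , w) → MissesAll⇒Fin'ω n (thresholds n w))
      where
      wins : ∀ n {A} → MissesAll n A → Game.Win (paths n) (paths-length n) 0 (λ _ → ⊤) A
      wins n (g , misses) = threshold⇒Win (paths-length n) λ x Ax _ sv →
        misses x Ax (All.map (λ f → f z≤n) (Survives⇒Good-above (paths-length n) sv))
        where open Game (paths n)

      thresholds : ∀ n {A} → Game.Win (paths n) (paths-length n) 0 (λ _ → ⊤) A → MissesAll n A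
      thresholds n w = let (g , h) = Win⇒threshold (paths-length n) w in
        g , λ x Ax good → h x Ax tt (Good⇒Survives (paths-length n)
          (subst (λ K → AtMost 0 K (paths n x)) (length-paths n x) (atMost-length (paths n x))) good)
        where open Game (paths n)

    Fin'ω-separates : Separates (Fin'ω X) (Fin'ω X)
    Fin'ω-separates = (λ A I → I) , λ A I⋆ I →
      proper (downward _ _ (λ m _ → ∨-inverseʳ (A m)) (union A (compl A) I I⋆))

    FinX⇒Fin'ω : ∀ n {A} → FinX X n A → Fin'ω X A
    FinX⇒Fin'ω n {A} fin = 1 , (λ _ → n) , (λ _ → A) , (λ _ → fin) , λ m Am → fzero , Am

    Σ⁰-not-separating : ∀ n S → Σ⁰ n S → ¬ Separates S (Fin'ω X)
    Σ⁰-not-separating n S σ (I⊆S , I⋆∩S) = ¬SA SA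
      where
      a = approximate n σ

      -- Causality permits the self-reference; cells of `X n` have `suc n` coordinates, the arity of
      -- the approximation of a `Σ⁰ n` set.
      fixed : ∃[ A ] (∀ k → A k ≡ φ a (index n k) k A)
      fixed = fixpoint (λ k → φ a (index n k) k) λ k → causal a (index n k) k

      A = proj₁ fixed

      ¬SA : ¬ S A
      ¬SA SA = let (g , h) = pos a A SA in I⋆∩S A
        (FinX⇒Fin'ω n (Misses⇒FinX n g λ x e good →
          not-¬ (trans (proj₂ fixed x) (h (index n x) x good)) (not-injective e))) SA

      SA : S A
      SA = em-stable λ ¬S → let (g , h) = neg a A ¬S in ¬S (I⊆S A
        (FinX⇒Fin'ω n (Misses⇒FinX n g λ x e good →
          not-¬ (trans (proj₂ fixed x) (h (index n x) x good)) e)))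

theorem4p5 : ExcludedMiddle 0ℓ → (X : PartFamily) → IsPartitionFamily X →
    IntersectionsInfinite X →
    IsIdeal (Fin'ω X) × Σ⁰ω (Fin'ω X) × RankIsω (Fin'ω X)
theorem4p5 em X part inter =
  isIdeal , Σ⁰ω-Fin'ω , ((Fin'ω X , Σ⁰ω-Fin'ω , Fin'ω-separates) , Σ⁰-not-separating)
  where open Classical.FinIdeal em X part inter
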